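{- $\theta(J(16,8)) = C_8 = 1430$ and $\theta(J(32,16)) = C_{16} = 35357670$, where $C_k=\frac{1}{k+1}\binom{2k}{k}$.
   Context: For integers $0<k<N$, the Johnson graph $J(N,k)$ has as vertices the $k$-element subsets of $\{1,\dots,N\}$, two being adjacent iff they share exactly $k-1$ elements. $\theta(G)$ denotes the smallest number of cliques of $G$ whose vertex sets together cover all vertices of $G$. -}

module Defs where

open import Level using (Level; suc; _⊔_) renaming (zero to lzero)
open import Data.Nat using (ℕ; _≤_; _∸_; _+_; _*_; _/_) renaming (suc to sucℕ)
open import Data.Nat.Combinatorics using (_C_)
open import Data.Fin using (Fin)
open import Data.Fin.Subset using (Subset; ∣_∣; _∩_)
open import Data.Product using (Σ; ∃; _×_)
open import Relation.Binary.PropositionalEquality using (_≡_; _≢_)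

record Graph : Set₁ where
  field
    V   : Set
    Adj : V → V → Set

open Graph public

IsClique : (G : Graph) → (V G → Set) → Set
IsClique G C = ∀ u v → C u → C v → u ≢ v → Adj G u v

CliqueCover : Graph → ℕ → Set₁
CliqueCover G m =
  Σ (Fin m → V G → Set) λ C →
    (∀ i → IsClique G (C i)) × (∀ v → ∃ λ i → C i v)

IsCliqueCoverNumber : Graph → ℕ → Set₁
IsCliqueCoverNumber G n = CliqueCover G n × (∀ m → CliqueCover G m → n ≤ m)

Johnson : ℕ → ℕ → Graph
Johnson N k = record
  { V   = Σ (Subset N) (λ s → ∣ s ∣ ≡ k)
  ; Adj = λ s t → ∣ Data.Product.proj₁ s ∩ Data.Product.proj₁ t ∣ ≡ k ∸ 1
  }

catalan : ℕ → ℕ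
catalan k = ((k + k) C k) / sucℕ k

-- Let k = 2^m and label the 2k points by the vectors of F₂^(m+1).  For a set y,
-- the k-sets obtained by adding or removing one element of y form a clique, of
-- size k + 1 when |y| = k ± 1.  A k-set p becomes a set with label sum zero under
-- exactly one such toggle, namely at the point labelled by the label sum of p.
-- Hence the sets y of size k ± 1 with label sum zero (the words of those weights
-- in a translate of the extended Hamming code) partition the k-sets into cliques
-- of size k + 1, so there are C(2k,k)/(k+1) of them.  Conversely, any clique of
-- J(2k,k) lies in such a ball: seen from one of its members a, the others are
-- exchanges a - x + y any two of which share x or share y, so either x or y is
-- constant.  Thus no clique has more than k + 1 vertices.

module Submission where

open import Defs
open import Data.Bool.Base using (not; _xor_; if_then_else_)
import Data.Bool.Properties as Bool
open import Data.Fin using (Fin; zero; suc; _↑ˡ_; _↑ʳ_; splitAt)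
open import Data.Fin.Properties using (splitAt-↑ˡ; splitAt-↑ʳ; *↔×; 2↔Bool)
  renaming (_≟_ to _≟ᶠ_)
open import Data.Fin.Subset
  using (Subset; inside; outside; ⊥; ⁅_⁆; ∁; _∈_; _∉_; _∩_; _─_; ∣_∣)
open import Data.Fin.Subset.Properties
open import Data.Nat
  using (ℕ; zero; suc; _+_; _*_; _∸_; _/_; _^_; _≤_; z≤n; _≟_; ⌊_/2⌋)
open import Data.Nat.Combinatorics using (_C_; nCk+nC[k+1]≡[n+1]C[k+1])
open import Data.Nat.DivMod using (m*n/n≡m)
open import Data.Nat.Properties
open import Algebra.Properties.Semiring.Sum +-*-semiring
open import Data.Product using (∃; ∃-syntax; _×_; _,_; proj₁; proj₂; uncurry)
open import Data.Product.Properties using (Σ-≡,≡→≡)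
open import Data.Product.Function.NonDependent.Propositional using (_×-↔_)
open import Data.Sum using (_⊎_; inj₁; inj₂; [_,_]′)
open import Data.Vec using ([]; _∷_; zipWith; updateAt; uncons; here; there)
open import Data.Vec.Properties
  using (≡-dec; zipWith-assoc; zipWith-comm; zipWith-identityʳ;
         updateAt-updateAt; updateAt-id-local)
open import Function using (_∘_; _⇔_; mk⇔; _↔_; mk↔ₛ′; Inverse; Equivalence)
open import Function.Properties.Inverse using (↔-trans)
open import Relation.Binary.PropositionalEquality
open import Relation.Nullary using (Dec; yes; no; does; contradiction)
open import Relation.Nullary.Decidable using (does-⇔; map′; _×-dec_; _⊎-dec_; ¬?)
open import Relation.Unary using (Decidable)

private variable
  m n k h : ℕ
  P Q : Set

-- Sums over all subsets and indicators

-- Families of subsets are counted by summing indicators, so that every double count below is an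
-- identity between sums over the cube.
∑⊆ : (Subset n → ℕ) → ℕ
∑⊆ {zero}  f = f []
∑⊆ {suc n} f = ∑⊆ (f ∘ (outside ∷_)) + ∑⊆ (f ∘ (inside ∷_))

∑⊆-cong : {f g : Subset n → ℕ} → (∀ p → f p ≡ g p) → ∑⊆ f ≡ ∑⊆ g
∑⊆-cong {zero}  f≗g = f≗g []
∑⊆-cong {suc n} f≗g = cong₂ _+_ (∑⊆-cong (f≗g ∘ (outside ∷_))) (∑⊆-cong (f≗g ∘ (inside ∷_)))

∑⊆-mono-≤ : {f g : Subset n → ℕ} → (∀ p → f p ≤ g p) → ∑⊆ f ≤ ∑⊆ g
∑⊆-mono-≤ {zero}  f≤g = f≤g []
∑⊆-mono-≤ {suc n} f≤g = +-mono-≤ (∑⊆-mono-≤ (f≤g ∘ (outside ∷_))) (∑⊆-mono-≤ (f≤g ∘ (inside ∷_)))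

∑⊆-zero : ∀ n → ∑⊆ {n} (λ _ → 0) ≡ 0
∑⊆-zero zero    = refl
∑⊆-zero (suc n) = cong₂ _+_ (∑⊆-zero n) (∑⊆-zero n)

∑⊆-*ʳ : ∀ c (f : Subset n → ℕ) → ∑⊆ (λ p → f p * c) ≡ ∑⊆ f * c
∑⊆-*ʳ {zero}  c f = refl
∑⊆-*ʳ {suc n} c f = trans (cong₂ _+_ (∑⊆-*ʳ c (f ∘ (outside ∷_))) (∑⊆-*ʳ c (f ∘ (inside ∷_))))
                          (sym (*-distribʳ-+ c (∑⊆ (f ∘ (outside ∷_))) _))

∑⊆-∑-comm : (f : Fin m → Subset n → ℕ) →
            ∑⊆ (λ p → ∑[ i < m ] f i p) ≡ ∑[ i < m ] ∑⊆ (f i)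
∑⊆-∑-comm {n = zero}  f = refl
∑⊆-∑-comm {n = suc n} f =
  trans (cong₂ _+_ (∑⊆-∑-comm (λ i → f i ∘ (outside ∷_))) (∑⊆-∑-comm (λ i → f i ∘ (inside ∷_))))
        (sym (∑-distrib-+ (λ i → ∑⊆ (f i ∘ (outside ∷_))) _))

≤-∑ : (f : Fin n → ℕ) → ∀ i → f i ≤ ∑[ j < n ] f j
≤-∑ f zero    = m≤m+n _ _
≤-∑ f (suc i) = ≤-trans (≤-∑ (f ∘ suc) i) (m≤n+m _ _)

∑-≤ : ∀ c (f : Fin n → ℕ) → (∀ i → f i ≤ c) → ∑[ j < n ] f j ≤ n * c
∑-≤ {zero}  c f f≤c = z≤n
∑-≤ {suc n} c f f≤c = +-mono-≤ (f≤c zero) (∑-≤ c (f ∘ suc) (f≤c ∘ suc))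

𝟙 : Dec P → ℕ
𝟙 P? = if does P? then 1 else 0

𝟙-cong : P ⇔ Q → (P? : Dec P) (Q? : Dec Q) → 𝟙 P? ≡ 𝟙 Q?
𝟙-cong P⇔Q P? Q? = cong (if_then 1 else 0) (does-⇔ P⇔Q P? Q?)

𝟙-true : (P? : Dec P) → P → 𝟙 P? ≡ 1
𝟙-true (yes _) p = refl
𝟙-true (no ¬p) p = contradiction p ¬p

𝟙-≤ : (P? : Dec P) → (P → 1 ≤ n) → 𝟙 P? ≤ n
𝟙-≤ (yes p) 1≤n = 1≤n p
𝟙-≤ (no _)  _   = z≤n

-- Allows a factor to be evaluated only on the support of the indicator.
𝟙-*-cong : (P? : Dec P) {a b : ℕ} → (P → a ≡ b) → 𝟙 P? * a ≡ 𝟙 P? * b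
𝟙-*-cong (yes p) a≡b = cong (_+ 0) (a≡b p)
𝟙-*-cong (no _)  _   = refl

_≟ˢ_ : (p q : Subset n) → Dec (p ≡ q)
_≟ˢ_ = ≡-dec Bool._≟_

∑⊆-𝟙≟ : (q : Subset n) → ∑⊆ (λ p → 𝟙 (p ≟ˢ q)) ≡ 1
∑⊆-𝟙≟ []                  = refl
∑⊆-𝟙≟ {suc n} (outside ∷ q) = cong₂ _+_ (∑⊆-𝟙≟ q) (∑⊆-zero n)
∑⊆-𝟙≟ {suc n} (inside ∷ q)  = cong₂ _+_ (∑⊆-zero n) (∑⊆-𝟙≟ q)

∑-𝟙∈ : (p : Subset n) → ∑[ i < n ] 𝟙 (i ∈? p) ≡ ∣ p ∣
∑-𝟙∈ []            = refl
∑-𝟙∈ (outside ∷ p) = ∑-𝟙∈ p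
∑-𝟙∈ (inside ∷ p)  = cong suc (∑-𝟙∈ p)

-- Splitting on whether the first point belongs to the set is Pascal's rule.
∑⊆-𝟙∣∣ : ∀ n k → ∑⊆ (λ (p : Subset n) → 𝟙 (∣ p ∣ ≟ k)) ≡ n C k
∑⊆-𝟙∣∣ zero    zero    = refl
∑⊆-𝟙∣∣ zero    (suc k) = refl
∑⊆-𝟙∣∣ (suc n) zero    = cong₂ _+_ (∑⊆-𝟙∣∣ n 0) (∑⊆-zero n)
∑⊆-𝟙∣∣ (suc n) (suc k) =
  trans (cong₂ _+_ (∑⊆-𝟙∣∣ n (suc k)) (∑⊆-𝟙∣∣ n k))
        (trans (+-comm (n C suc k) _) (nCk+nC[k+1]≡[n+1]C[k+1] n k))

-- Indexes `D` by its own count, so that the size of a code becomes the number of cliques in a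
-- cover.
enumerate : {D : Subset n → Set} (D? : Decidable D) →
            ∃ λ (e : Fin (∑⊆ (λ p → 𝟙 (D? p))) → Subset n) → ∀ p → D p → ∃[ i ] e i ≡ p
enumerate {zero} D? = (λ _ → []) , covers
  where
  covers : ∀ p → _ → ∃[ i ] [] ≡ p
  covers [] d = subst Fin (sym (𝟙-true (D? []) d)) zero , refl
enumerate {suc n} {D} D? = e , covers
  where
  out = enumerate (D? ∘ (outside ∷_))
  inn = enumerate (D? ∘ (inside ∷_))
  a = ∑⊆ (λ p → 𝟙 (D? (outside ∷ p)))
  b = ∑⊆ (λ p → 𝟙 (D? (inside ∷ p)))
  e : Fin (a + b) → Subset (suc n)
  e i = [ (outside ∷_) ∘ proj₁ out , (inside ∷_) ∘ proj₁ inn ]′ (splitAt a i)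
  covers : ∀ p → D p → ∃[ i ] e i ≡ p
  covers (outside ∷ p) d with i , eq ← proj₂ out p d
    = i ↑ˡ b , trans (cong [ _ , _ ]′ (splitAt-↑ˡ a i b)) (cong (outside ∷_) eq)
  covers (inside ∷ p) d with i , eq ← proj₂ inn p d
    = a ↑ʳ i , trans (cong [ _ , _ ]′ (splitAt-↑ʳ a b i)) (cong (inside ∷_) eq)

-- Toggling one element, and symmetric difference

toggle : Fin n → Subset n → Subset n
toggle i p = updateAt p i not

toggle-involutive : ∀ i (p : Subset n) → toggle i (toggle i p) ≡ p
toggle-involutive i p =
  trans (updateAt-updateAt i p) (updateAt-id-local i p (Bool.not-involutive _))

toggle-comm : ∀ i j (p : Subset n) → toggle i (toggle j p) ≡ toggle j (toggle i p)
toggle-comm zero    zero    (_ ∷ p) = refl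
toggle-comm zero    (suc j) (_ ∷ p) = refl
toggle-comm (suc i) zero    (_ ∷ p) = refl
toggle-comm (suc i) (suc j) (s ∷ p) = cong (s ∷_) (toggle-comm i j p)

∣toggle∣-∈ : ∀ {i} {p : Subset n} → i ∈ p → suc ∣ toggle i p ∣ ≡ ∣ p ∣
∣toggle∣-∈ here                        = refl
∣toggle∣-∈ {p = outside ∷ _} (there i∈p) = ∣toggle∣-∈ i∈p
∣toggle∣-∈ {p = inside ∷ _}  (there i∈p) = cong suc (∣toggle∣-∈ i∈p)

∣toggle∣-∉ : ∀ {i} {p : Subset n} → i ∉ p → ∣ toggle i p ∣ ≡ suc ∣ p ∣
∣toggle∣-∉ {i = zero}  {outside ∷ p} _   = refl
∣toggle∣-∉ {i = zero}  {inside ∷ p}  i∉p = contradiction here i∉p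
∣toggle∣-∉ {i = suc i} {outside ∷ p} i∉p = ∣toggle∣-∉ (i∉p ∘ there)
∣toggle∣-∉ {i = suc i} {inside ∷ p}  i∉p = cong suc (∣toggle∣-∉ (i∉p ∘ there))

-- A toggle permutes the cube; at the first coordinate it swaps the two halves of the sum.
∑⊆-toggle : ∀ i (f : Subset n → ℕ) → ∑⊆ (f ∘ toggle i) ≡ ∑⊆ f
∑⊆-toggle zero    f = +-comm (∑⊆ (f ∘ (inside ∷_))) _
∑⊆-toggle (suc i) f = cong₂ _+_ (∑⊆-toggle i (f ∘ (outside ∷_))) (∑⊆-toggle i (f ∘ (inside ∷_)))

-- The adjacency operator of the hypercube is self-adjoint.
∑⊆-toggle-adjoint : (f g : Subset n → ℕ) →
  ∑⊆ (λ p → f p * ∑[ i < n ] g (toggle i p)) ≡ ∑⊆ (λ p → g p * ∑[ i < n ] f (toggle i p))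
∑⊆-toggle-adjoint {n} f g = begin
  ∑⊆ (λ p → f p * ∑[ i < n ] g (toggle i p))      ≡⟨ expand f g ⟩
  ∑[ i < n ] ∑⊆ (λ p → f p * g (toggle i p))      ≡⟨ sum-cong-≗ swap ⟩
  ∑[ i < n ] ∑⊆ (λ p → g p * f (toggle i p))      ≡⟨ expand g f ⟨
  ∑⊆ (λ p → g p * ∑[ i < n ] f (toggle i p))      ∎
  where
  open ≡-Reasoning
  expand : ∀ f g → ∑⊆ (λ p → f p * ∑[ i < n ] g (toggle i p))
                 ≡ ∑[ i < n ] ∑⊆ (λ p → f p * g (toggle i p))
  expand f g = trans (∑⊆-cong λ p → *-distribˡ-sum (f p) (λ i → g (toggle i p)))
                     (∑⊆-∑-comm (λ i p → f p * g (toggle i p)))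
  swap : ∀ i → ∑⊆ (λ p → f p * g (toggle i p)) ≡ ∑⊆ (λ p → g p * f (toggle i p))
  swap i = begin
    ∑⊆ (λ p → f p * g (toggle i p))
      ≡⟨ ∑⊆-toggle i _ ⟨
    ∑⊆ (λ p → f (toggle i p) * g (toggle i (toggle i p)))
      ≡⟨ ∑⊆-cong (λ p → trans (*-comm (f (toggle i p)) _)
                               (cong (λ q → g q * f (toggle i p)) (toggle-involutive i p))) ⟩
    ∑⊆ (λ p → g p * f (toggle i p)) ∎

infixl 6 _⊕_
_⊕_ : Subset n → Subset n → Subset n
_⊕_ = zipWith _xor_

⊕-assoc : (p q r : Subset n) → (p ⊕ q) ⊕ r ≡ p ⊕ (q ⊕ r)
⊕-assoc = zipWith-assoc Bool.xor-assoc

⊕-comm : (p q : Subset n) → p ⊕ q ≡ q ⊕ p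
⊕-comm = zipWith-comm Bool.xor-comm

⊕-identityʳ : (p : Subset n) → p ⊕ ⊥ ≡ p
⊕-identityʳ = zipWith-identityʳ Bool.xor-identityʳ

⊕-self : (p : Subset n) → p ⊕ p ≡ ⊥
⊕-self []      = refl
⊕-self (s ∷ p) = cong₂ _∷_ (Bool.xor-same s) (⊕-self p)

⊕-cancelˡ : (p q : Subset n) → p ⊕ (p ⊕ q) ≡ q
⊕-cancelˡ p q = begin
  p ⊕ (p ⊕ q) ≡⟨ ⊕-assoc p p q ⟨
  p ⊕ p ⊕ q   ≡⟨ cong (_⊕ q) (⊕-self p) ⟩
  ⊥ ⊕ q       ≡⟨ ⊕-comm ⊥ q ⟩
  q ⊕ ⊥       ≡⟨ ⊕-identityʳ q ⟩
  q           ∎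
  where open ≡-Reasoning

⊕≡⊥⇒≡ : {p q : Subset n} → p ⊕ q ≡ ⊥ → p ≡ q
⊕≡⊥⇒≡ {p = p} {q} eq = begin
  p           ≡⟨ ⊕-identityʳ p ⟨
  p ⊕ ⊥       ≡⟨ cong (p ⊕_) eq ⟨
  p ⊕ (p ⊕ q) ≡⟨ ⊕-cancelˡ p q ⟩
  q           ∎
  where open ≡-Reasoning

toggle-⊕ : ∀ i (p : Subset n) → toggle i p ≡ ⁅ i ⁆ ⊕ p
toggle-⊕ zero    (s ∷ p) = cong (not s ∷_) (sym (trans (⊕-comm ⊥ p) (⊕-identityʳ p)))
toggle-⊕ (suc i) (s ∷ p) = cong (s ∷_) (toggle-⊕ i p)

-- Adding `p ─ q` deletes what only `p` has, and adding `q ─ p` inserts what only `q` has. When both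
-- are singletons this reads as two toggles.
─-⊕-─ : (p q : Subset n) → q ≡ (q ─ p) ⊕ ((p ─ q) ⊕ p)
─-⊕-─ []            []            = refl
─-⊕-─ (outside ∷ p) (outside ∷ q) = cong (outside ∷_) (─-⊕-─ p q)
─-⊕-─ (outside ∷ p) (inside ∷ q)  = cong (inside ∷_) (─-⊕-─ p q)
─-⊕-─ (inside ∷ p)  (outside ∷ q) = cong (outside ∷_) (─-⊕-─ p q)
─-⊕-─ (inside ∷ p)  (inside ∷ q)  = cong (inside ∷_) (─-⊕-─ p q)

∣⊕∣+2∣∩∣ : (p q : Subset n) → ∣ p ⊕ q ∣ + (∣ p ∩ q ∣ + ∣ p ∩ q ∣) ≡ ∣ p ∣ + ∣ q ∣
∣⊕∣+2∣∩∣ []            []            = refl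
∣⊕∣+2∣∩∣ (outside ∷ p) (outside ∷ q) = ∣⊕∣+2∣∩∣ p q
∣⊕∣+2∣∩∣ (outside ∷ p) (inside ∷ q)  = trans (cong suc (∣⊕∣+2∣∩∣ p q)) (sym (+-suc ∣ p ∣ _))
∣⊕∣+2∣∩∣ (inside ∷ p)  (outside ∷ q) = cong suc (∣⊕∣+2∣∩∣ p q)
∣⊕∣+2∣∩∣ (inside ∷ p)  (inside ∷ q)  = begin
  ∣ p ⊕ q ∣ + (suc ∣ p ∩ q ∣ + suc ∣ p ∩ q ∣)     ≡⟨ +-suc ∣ p ⊕ q ∣ _ ⟩
  suc (∣ p ⊕ q ∣ + (∣ p ∩ q ∣ + suc ∣ p ∩ q ∣))   ≡⟨ cong (λ x → suc (∣ p ⊕ q ∣ + x)) (+-suc ∣ p ∩ q ∣ _) ⟩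
  suc (∣ p ⊕ q ∣ + suc (∣ p ∩ q ∣ + ∣ p ∩ q ∣))   ≡⟨ cong suc (+-suc ∣ p ⊕ q ∣ _) ⟩
  suc (suc (∣ p ⊕ q ∣ + (∣ p ∩ q ∣ + ∣ p ∩ q ∣))) ≡⟨ cong (2 +_) (∣⊕∣+2∣∩∣ p q) ⟩
  suc (suc (∣ p ∣ + ∣ q ∣))                       ≡⟨ cong suc (+-suc ∣ p ∣ _) ⟨
  suc (∣ p ∣ + suc ∣ q ∣)                         ∎
  where open ≡-Reasoning

∣─∣+∣∩∣ : (p q : Subset n) → ∣ p ─ q ∣ + ∣ p ∩ q ∣ ≡ ∣ p ∣
∣─∣+∣∩∣ []            []            = refl
∣─∣+∣∩∣ (outside ∷ p) (outside ∷ q) = ∣─∣+∣∩∣ p q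
∣─∣+∣∩∣ (outside ∷ p) (inside ∷ q)  = ∣─∣+∣∩∣ p q
∣─∣+∣∩∣ (inside ∷ p)  (outside ∷ q) = cong suc (∣─∣+∣∩∣ p q)
∣─∣+∣∩∣ (inside ∷ p)  (inside ∷ q)  = trans (+-suc ∣ p ─ q ∣ _) (cong suc (∣─∣+∣∩∣ p q))

x∈p─q⇒x∉q : ∀ {x} (p q : Subset n) → x ∈ p ─ q → x ∉ q
x∈p─q⇒x∉q (_ ∷ p) (outside ∷ q) (there x∈p─q) (there x∈q) = x∈p─q⇒x∉q p q x∈p─q x∈q
x∈p─q⇒x∉q (_ ∷ p) (inside ∷ q)  (there x∈p─q) (there x∈q) = x∈p─q⇒x∉q p q x∈p─q x∈q

∣p∣≡0⇒p≡⊥ : (p : Subset n) → ∣ p ∣ ≡ 0 → p ≡ ⊥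
∣p∣≡0⇒p≡⊥ []            _  = refl
∣p∣≡0⇒p≡⊥ (outside ∷ p) eq = cong (outside ∷_) (∣p∣≡0⇒p≡⊥ p eq)

∣p∣≡1⇒p≡⁅x⁆ : (p : Subset n) → ∣ p ∣ ≡ 1 → ∃[ x ] p ≡ ⁅ x ⁆
∣p∣≡1⇒p≡⁅x⁆ (outside ∷ p) eq with x , p≡⁅x⁆ ← ∣p∣≡1⇒p≡⁅x⁆ p eq = suc x , cong (outside ∷_) p≡⁅x⁆
∣p∣≡1⇒p≡⁅x⁆ (inside ∷ p)  eq = zero , cong (inside ∷_) (∣p∣≡0⇒p≡⊥ p (suc-injective eq))

-- Balls in the hypercube

-- A toggle in the wrong direction misses the intended size by two; this rules it out in the next
-- two equivalences.
n≢2+n : ∀ n → n ≢ 2 + n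
n≢2+n n = <⇒≢ (m<n⇒m<1+n (n<1+n n))

∣toggle∣≡⇔∈ : ∀ {i} {p : Subset n} → ∣ p ∣ ≡ suc k → ∣ toggle i p ∣ ≡ k ⇔ i ∈ p
∣toggle∣≡⇔∈ {k = k} {i} {p} ∣p∣≡ = mk⇔ to (λ i∈p → suc-injective (trans (∣toggle∣-∈ i∈p) ∣p∣≡))
  where
  to : ∣ toggle i p ∣ ≡ k → i ∈ p
  to eq with i ∈? p
  ... | yes i∈p = i∈p
  ... | no i∉p  = contradiction (trans (sym eq) (trans (∣toggle∣-∉ i∉p) (cong suc ∣p∣≡))) (n≢2+n k)

∣toggle∣≡⇔∈∁ : ∀ {i} {p : Subset n} → suc ∣ p ∣ ≡ k → ∣ toggle i p ∣ ≡ k ⇔ i ∈ ∁ p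
∣toggle∣≡⇔∈∁ {i = i} {p} refl = mk⇔ (x∉p⇒x∈∁p ∘ to) (∣toggle∣-∉ ∘ x∈∁p⇒x∉p)
  where
  to : ∣ toggle i p ∣ ≡ suc ∣ p ∣ → i ∉ p
  to eq i∈p = n≢2+n ∣ p ∣ (trans (sym (∣toggle∣-∈ i∈p)) (cong suc eq))

-- With k = h + 1, a set of size k - 1 reaches the middle layer by gaining any of its 2k - h = h + 2
-- absent points, and a set of size k + 1 by losing any of its h + 2 points.
∑-toggle-degree : (y : Subset (suc h + suc h)) → ∣ y ∣ ≡ h ⊎ ∣ y ∣ ≡ 2 + h →
                  ∑[ i < suc h + suc h ] 𝟙 (∣ toggle i y ∣ ≟ suc h) ≡ 2 + h
∑-toggle-degree {h} y (inj₁ ∣y∣≡h) = begin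
  ∑[ i < suc h + suc h ] 𝟙 (∣ toggle i y ∣ ≟ suc h)
    ≡⟨ sum-cong-≗ (λ i → 𝟙-cong (∣toggle∣≡⇔∈∁ (cong suc ∣y∣≡h)) (_ ≟ _) (i ∈? ∁ y)) ⟩
  ∑[ i < suc h + suc h ] 𝟙 (i ∈? ∁ y)  ≡⟨ ∑-𝟙∈ (∁ y) ⟩
  ∣ ∁ y ∣                              ≡⟨ ∣∁p∣≡n∸∣p∣ y ⟩
  suc h + suc h ∸ ∣ y ∣                ≡⟨ cong₂ _∸_ (+-suc (suc h) h) ∣y∣≡h ⟩
  2 + h + h ∸ h                        ≡⟨ m+n∸n≡m (2 + h) h ⟩
  2 + h                                ∎
  where open ≡-Reasoning
∑-toggle-degree y (inj₂ ∣y∣≡2+h) =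
  trans (sum-cong-≗ (λ i → 𝟙-cong (∣toggle∣≡⇔∈ ∣y∣≡2+h) (_ ≟ _) (i ∈? y)))
        (trans (∑-𝟙∈ y) ∣y∣≡2+h)

-- Distinct toggles u, v of one set differ exactly in `i` and `j`, so |u ⊕ v| = 2. Since |u| + |v| =
-- 2h + 2, this leaves 2|u ∩ v| = 2h.
ball-adjacent : ∀ (y : Subset n) i j → ∣ toggle i y ∣ ≡ suc h → ∣ toggle j y ∣ ≡ suc h →
                toggle i y ≢ toggle j y → ∣ toggle i y ∩ toggle j y ∣ ≡ h
ball-adjacent {h = h} y i j ∣u∣≡ ∣v∣≡ u≢v = begin
  ∣ u ∩ v ∣                        ≡⟨ n≡⌊n+n/2⌋ _ ⟩
  ⌊ ∣ u ∩ v ∣ + ∣ u ∩ v ∣ /2⌋      ≡⟨ cong ⌊_/2⌋ (suc-injective (suc-injective double)) ⟩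
  ⌊ h + h /2⌋                      ≡⟨ n≡⌊n+n/2⌋ h ⟨
  h                                ∎
  where
  open ≡-Reasoning
  u = toggle i y
  v = toggle j y
  u⊕v : u ⊕ v ≡ toggle i ⁅ j ⁆
  u⊕v = begin
    u ⊕ v                       ≡⟨ cong₂ _⊕_ (toggle-⊕ i y) (toggle-⊕ j y) ⟩
    (⁅ i ⁆ ⊕ y) ⊕ (⁅ j ⁆ ⊕ y)   ≡⟨ ⊕-assoc ⁅ i ⁆ y _ ⟩
    ⁅ i ⁆ ⊕ (y ⊕ (⁅ j ⁆ ⊕ y))   ≡⟨ cong (λ z → ⁅ i ⁆ ⊕ (y ⊕ z)) (⊕-comm ⁅ j ⁆ y) ⟩
    ⁅ i ⁆ ⊕ (y ⊕ (y ⊕ ⁅ j ⁆))   ≡⟨ cong (⁅ i ⁆ ⊕_) (⊕-cancelˡ y ⁅ j ⁆) ⟩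
    ⁅ i ⁆ ⊕ ⁅ j ⁆               ≡⟨ toggle-⊕ i ⁅ j ⁆ ⟨
    toggle i ⁅ j ⁆              ∎
  i∉⁅j⁆ : i ∉ ⁅ j ⁆
  i∉⁅j⁆ i∈⁅j⁆ = u≢v (cong (λ l → toggle l y) (x∈⁅y⁆⇒x≡y j i∈⁅j⁆))
  double : 2 + (∣ u ∩ v ∣ + ∣ u ∩ v ∣) ≡ 2 + (h + h)
  double = begin
    2 + (∣ u ∩ v ∣ + ∣ u ∩ v ∣)
      ≡⟨ cong (λ l → suc l + (∣ u ∩ v ∣ + ∣ u ∩ v ∣)) (∣⁅x⁆∣≡1 j) ⟨
    suc ∣ ⁅ j ⁆ ∣ + (∣ u ∩ v ∣ + ∣ u ∩ v ∣)
      ≡⟨ cong (_+ (∣ u ∩ v ∣ + ∣ u ∩ v ∣)) (trans (cong ∣_∣ u⊕v) (∣toggle∣-∉ i∉⁅j⁆)) ⟨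
    ∣ u ⊕ v ∣ + (∣ u ∩ v ∣ + ∣ u ∩ v ∣)
      ≡⟨ ∣⊕∣+2∣∩∣ u v ⟩
    ∣ u ∣ + ∣ v ∣
      ≡⟨ cong₂ _+_ ∣u∣≡ ∣v∣≡ ⟩
    suc h + suc h
      ≡⟨ +-suc (suc h) h ⟩
    2 + (h + h) ∎

-- Cliques of the Johnson graph lie in balls

-- Both differences are stored as singletons, so an element of one set that is missing from the
-- other is identified at once.
record Exchange (a c : Subset n) : Set where
  field
    removed added : Fin n
    a─c≡ : a ─ c ≡ ⁅ removed ⁆
    c─a≡ : c ─ a ≡ ⁅ added ⁆

  private
    removed∈a─c : removed ∈ a ─ c
    removed∈a─c = subst (removed ∈_) (sym a─c≡) (x∈⁅x⁆ removed)

    added∈c─a : added ∈ c ─ a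
    added∈c─a = subst (added ∈_) (sym c─a≡) (x∈⁅x⁆ added)

  removed∈ : removed ∈ a
  removed∈ = p─q⊆p a c removed∈a─c

  removed∉ : removed ∉ c
  removed∉ = x∈p─q⇒x∉q a c removed∈a─c

  added∈ : added ∈ c
  added∈ = p─q⊆p c a added∈c─a

  added∉ : added ∉ a
  added∉ = x∈p─q⇒x∉q c a added∈c─a

  removed-unique : ∀ {x} → x ∈ a → x ∉ c → x ≡ removed
  removed-unique x∈a x∉c = x∈⁅y⁆⇒x≡y removed (subst (_ ∈_) a─c≡ (x∈p∧x∉q⇒x∈p─q x∈a x∉c))

  added-unique : ∀ {x} → x ∈ c → x ∉ a → x ≡ added
  added-unique x∈c x∉a = x∈⁅y⁆⇒x≡y added (subst (_ ∈_) c─a≡ (x∈p∧x∉q⇒x∈p─q x∈c x∉a))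

  toggles : c ≡ toggle added (toggle removed a)
  toggles = begin
    c                                ≡⟨ ─-⊕-─ a c ⟩
    (c ─ a) ⊕ ((a ─ c) ⊕ a)          ≡⟨ cong₂ (λ p q → p ⊕ (q ⊕ a)) c─a≡ a─c≡ ⟩
    ⁅ added ⁆ ⊕ (⁅ removed ⁆ ⊕ a)    ≡⟨ cong (⁅ added ⁆ ⊕_) (toggle-⊕ removed a) ⟨
    ⁅ added ⁆ ⊕ toggle removed a     ≡⟨ toggle-⊕ added _ ⟨
    toggle added (toggle removed a)  ∎
    where open ≡-Reasoning

open Exchange

exchange : {a c : Subset n} → ∣ a ∣ ≡ suc h → ∣ c ∣ ≡ suc h → ∣ a ∩ c ∣ ≡ h → Exchange a c
exchange {h = h} {a} {c} ∣a∣≡ ∣c∣≡ ∣a∩c∣≡ = record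
  { removed = proj₁ removal ; added = proj₁ addition
  ; a─c≡ = proj₂ removal ; c─a≡ = proj₂ addition }
  where
  singleton : ∀ p q → ∣ p ∣ ≡ suc h → ∣ p ∩ q ∣ ≡ h → ∃[ x ] p ─ q ≡ ⁅ x ⁆
  singleton p q ∣p∣≡ ∣p∩q∣≡ = ∣p∣≡1⇒p≡⁅x⁆ (p ─ q) (+-cancelʳ-≡ h _ 1
    (trans (cong (∣ p ─ q ∣ +_) (sym ∣p∩q∣≡)) (trans (∣─∣+∣∩∣ p q) ∣p∣≡)))
  removal  = singleton a c ∣a∣≡ ∣a∩c∣≡
  addition = singleton c a ∣c∣≡ (trans (cong ∣_∣ (∩-comm c a)) ∣a∩c∣≡)

-- Two exchanges differing in both entries yield sets differing in two elements.
share : {a c d : Subset n} (e : Exchange a c) (e′ : Exchange a d) → (c ≢ d → Exchange c d) →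
        removed e ≡ removed e′ ⊎ added e ≡ added e′
share {a = a} {c} {d} e e′ c~d with removed e ≟ᶠ removed e′ | added e ≟ᶠ added e′
... | yes eq | _      = inj₁ eq
... | no _   | yes eq = inj₂ eq
... | no r≢  | no a≢  = contradiction (subst (_∈ a) removed′≡added (removed∈ e′)) (added∉ e)
  where
  added∉d : added e ∉ d
  added∉d added∈d = a≢ (added-unique e′ added∈d (added∉ e))
  removed′∈c : removed e′ ∈ c
  removed′∈c with removed e′ ∈? c
  ... | yes ∈c = ∈c
  ... | no ∉c  = contradiction (sym (removed-unique e (removed∈ e′) ∉c)) r≢
  f : Exchange c d
  f = c~d λ c≡d → added∉d (subst (added e ∈_) c≡d (added∈ e))
  -- Both elements lie in the singleton `c ─ d`, although the first belongs to `a` and the second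
  -- does not.
  removed′≡added : removed e′ ≡ added e
  removed′≡added = trans (removed-unique f removed′∈c (removed∉ e′))
                         (sym (removed-unique f (added∈ e) added∉d))

module _ {F : Subset n → Set} (F? : Decidable F)
         (size : ∀ {p} → F p → ∣ p ∣ ≡ suc h)
         (meet : ∀ {p q} → F p → F q → p ≢ q → ∣ p ∩ q ∣ ≡ h) where

  private
    -- The two sizes are k - 1 and k + 1 for k = h + 1: the centre lies just below or just above the
    -- layer of the clique.
    IsCentre : Subset n → Set
    IsCentre y = (∣ y ∣ ≡ h ⊎ ∣ y ∣ ≡ 2 + h) × (∀ {p} → F p → ∃[ i ] p ≡ toggle i y)

    exch : ∀ {p q} → F p → F q → p ≢ q → Exchange p q
    exch Fp Fq p≢q = exchange (size Fp) (size Fq) (meet Fp Fq p≢q)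

    -- Every exchange from `a` must remove `i`, so the members are `a` without `i`, plus one element
    -- each.
    centre-below : ∀ {a i} → F a → i ∈ a → (∀ {c} → F c → a ≢ c → i ∉ c) → IsCentre (toggle i a)
    centre-below {a} {i} Fa i∈a i∉ =
      inj₁ (suc-injective (trans (∣toggle∣-∈ i∈a) (size Fa))) , ball
      where
      ball : ∀ {c} → F c → ∃[ j ] c ≡ toggle j (toggle i a)
      ball {c} Fc with a ≟ˢ c
      ... | yes refl = i , sym (toggle-involutive i a)
      ... | no a≢c   = added e , subst (λ l → c ≡ toggle (added e) (toggle l a))
                                       (sym (removed-unique e i∈a (i∉ Fc a≢c))) (toggles e)
        where e = exch Fa Fc a≢c

    -- Every exchange from `a` must add `j`, so the members are `a` with `j`, minus one element
    -- each.
    centre-above : ∀ {a j} → F a → j ∉ a → (∀ {c} → F c → a ≢ c → j ∈ c) → IsCentre (toggle j a)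
    centre-above {a} {j} Fa j∉a j∈ =
      inj₂ (trans (∣toggle∣-∉ j∉a) (cong suc (size Fa))) , ball
      where
      ball : ∀ {c} → F c → ∃[ i ] c ≡ toggle i (toggle j a)
      ball {c} Fc with a ≟ˢ c
      ... | yes refl = j , sym (toggle-involutive j a)
      ... | no a≢c   = removed e , trans (toggles e) (trans (toggle-comm (added e) (removed e) a)
                         (cong (λ l → toggle (removed e) (toggle l a))
                               (sym (added-unique e (j∈ Fc a≢c) j∉a))))
        where e = exch Fa Fc a≢c

  -- Fix members `a` and `b`. Either every other member lacks the element removed on passing from
  -- `a` to `b`, or some `c` keeps it, and then all exchanges from `a` add the same element.
  clique-centre : ∃ F → ∃ IsCentre
  clique-centre (a , Fa) with anySubset? (λ b → F? b ×-dec ¬? (a ≟ˢ b))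
  clique-centre (a , Fa) | no ¬b with nonempty? a
  -- The clique is just `a`, so any of its elements will do.
  ... | yes (i , i∈a) = _ , centre-below Fa i∈a λ Fc a≢c → contradiction (_ , Fc , a≢c) ¬b
  ... | no ∄i         = contradiction (trans (sym (size Fa)) (trans (cong ∣_∣ (Empty-unique ∄i)) (∣⊥∣≡0 n))) λ ()
  clique-centre (a , Fa) | yes (b , Fb , a≢b)
    with anySubset? (λ c → F? c ×-dec ¬? (a ≟ˢ c) ×-dec (removed e ∈? c))
    where e = exch Fa Fb a≢b
  ... | no ¬c = _ , centre-below Fa (removed∈ e) λ Fc a≢c i∈c → ¬c (_ , Fc , a≢c , i∈c)
    where e = exch Fa Fb a≢b
  ... | yes (c , Fc , a≢c , i∈c) = _ , centre-above Fa (added∉ e) j∈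
    where
    e  = exch Fa Fb a≢b
    e′ = exch Fa Fc a≢c
    removed≢ : removed e ≢ removed e′
    removed≢ eq = removed∉ e′ (subst (_∈ c) eq i∈c)
    j∈ : ∀ {d} → F d → a ≢ d → added e ∈ d
    j∈ {d} Fd a≢d = subst (_∈ d) (sym added≡) (added∈ e″)
      where
      e″ = exch Fa Fd a≢d
      added≡ : added e ≡ added e″
      added≡ with share e e″ (exch Fb Fd)
      ... | inj₂ eq = eq
      -- If `e″` removes the same element as `e`, both differ from `e′` in the removed element. Each
      -- therefore shares its added element with `e′`.
      ... | inj₁ eq with share e e′ (exch Fb Fc) | share e′ e″ (exch Fc Fd)
      ...   | inj₁ eq′ | _        = contradiction eq′ removed≢
      ...   | inj₂ _   | inj₁ eq″ = contradiction (trans eq (sym eq″)) removed≢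
      ...   | inj₂ eq′ | inj₂ eq″ = trans eq′ eq″

-- Clique sizes and the lower bound

-- The indicator of a nonempty clique is bounded by that of the ball around its centre `y`.
-- Adjointness turns the size of this ball into the number of toggles taking `y` to the middle
-- layer.
clique-size : {F : Subset (suc h + suc h) → Set} (F? : Decidable F) →
              (∀ {p} → F p → ∣ p ∣ ≡ suc h) →
              (∀ {p q} → F p → F q → p ≢ q → ∣ p ∩ q ∣ ≡ h) →
              ∑⊆ (λ p → 𝟙 (F? p)) ≤ 2 + h
clique-size {h} {F} F? size meet with anySubset? F?
... | no ∄F = begin
  ∑⊆ (λ p → 𝟙 (F? p))            ≤⟨ ∑⊆-mono-≤ {g = λ _ → 0} (λ p → 𝟙-≤ (F? p) (λ Fp → contradiction (p , Fp) ∄F)) ⟩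
  ∑⊆ {suc h + suc h} (λ _ → 0)   ≡⟨ ∑⊆-zero (suc h + suc h) ⟩
  0                              ≤⟨ z≤n ⟩
  2 + h                          ∎
  where open ≤-Reasoning
... | yes ∃F with y , ∣y∣≡ , ball ← clique-centre F? size meet ∃F = begin
  ∑⊆ (λ p → 𝟙 (F? p))
    ≤⟨ ∑⊆-mono-≤ (λ p → 𝟙-≤ (F? p) (ball-member p)) ⟩
  ∑⊆ (λ p → 𝟙 (∣ p ∣ ≟ suc h) * ∑[ i < suc h + suc h ] 𝟙 (toggle i p ≟ˢ y))
    ≡⟨ ∑⊆-toggle-adjoint (λ p → 𝟙 (∣ p ∣ ≟ suc h)) (λ p → 𝟙 (p ≟ˢ y)) ⟩
  ∑⊆ (λ p → 𝟙 (p ≟ˢ y) * ∑[ i < suc h + suc h ] 𝟙 (∣ toggle i p ∣ ≟ suc h))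
    ≡⟨ ∑⊆-cong (λ p → 𝟙-*-cong (p ≟ˢ y) (degree p)) ⟩
  ∑⊆ (λ p → 𝟙 (p ≟ˢ y) * (2 + h))
    ≡⟨ ∑⊆-*ʳ (2 + h) (λ p → 𝟙 (p ≟ˢ y)) ⟩
  ∑⊆ (λ p → 𝟙 (p ≟ˢ y)) * (2 + h)
    ≡⟨ cong (_* (2 + h)) (∑⊆-𝟙≟ y) ⟩
  1 * (2 + h)
    ≡⟨ *-identityˡ (2 + h) ⟩
  2 + h ∎
  where
  open ≤-Reasoning
  degree : ∀ p → p ≡ y → ∑[ i < suc h + suc h ] 𝟙 (∣ toggle i p ∣ ≟ suc h) ≡ 2 + h
  degree p refl = ∑-toggle-degree p ∣y∣≡
  ball-member : ∀ p → F p → 1 ≤ 𝟙 (∣ p ∣ ≟ suc h) * ∑[ i < suc h + suc h ] 𝟙 (toggle i p ≟ˢ y)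
  ball-member p Fp with i , eq ← ball Fp =
    *-mono-≤ (≤-reflexive (sym (𝟙-true (∣ p ∣ ≟ suc h) (size Fp))))
      (≤-trans (≤-reflexive (sym (𝟙-true (toggle i p ≟ˢ y) (trans (cong (toggle i) eq) (toggle-involutive i y)))))
               (≤-∑ (λ i → 𝟙 (toggle i p ≟ˢ y)) i))

-- Each k-set is charged to one clique containing it, and no clique is charged more than h + 2
-- times.
cover-lower-bound : CliqueCover (Johnson (suc h + suc h) (suc h)) m →
                    (suc h + suc h) C suc h ≤ m * (2 + h)
cover-lower-bound {h} {m} (clq , clique , cover) = begin
  N C suc h                                  ≡⟨ ∑⊆-𝟙∣∣ N (suc h) ⟨
  ∑⊆ (λ (p : Subset N) → 𝟙 (∣ p ∣ ≟ suc h))  ≤⟨ ∑⊆-mono-≤ (λ p → 𝟙-≤ (∣ p ∣ ≟ suc h) (covered p)) ⟩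
  ∑⊆ (λ p → ∑[ i < m ] 𝟙 (F? i p))           ≡⟨ ∑⊆-∑-comm (λ i p → 𝟙 (F? i p)) ⟩
  ∑[ i < m ] ∑⊆ (λ p → 𝟙 (F? i p))           ≤⟨ ∑-≤ (2 + h) _ (λ i → clique-size (F? i) proj₁ (meet i)) ⟩
  m * (2 + h)                                ∎
  where
  open ≤-Reasoning
  N = suc h + suc h
  -- The cliques of a cover are arbitrary predicates. Taking instead the vertices for which `cover`
  -- selects index `i` gives decidable subfamilies that still exhaust the k-sets.
  F : Fin m → Subset N → Set
  F i p = ∃[ ∣p∣≡ ] proj₁ (cover (p , ∣p∣≡)) ≡ i
  F? : ∀ i → Decidable (F i)
  F? i p with ∣ p ∣ ≟ suc h
  ... | no ∣p∣≢  = no (∣p∣≢ ∘ proj₁)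
  -- The selected index does not depend on the proof of the size, since such proofs are unique.
  ... | yes ∣p∣≡ = map′ (∣p∣≡ ,_) (λ { (eq , f) → trans (cong (λ e → proj₁ (cover (p , e))) (≡-irrelevant ∣p∣≡ eq)) f })
                        (proj₁ (cover (p , ∣p∣≡)) ≟ᶠ i)
  covered : ∀ p → ∣ p ∣ ≡ suc h → 1 ≤ ∑[ i < m ] 𝟙 (F? i p)
  covered p ∣p∣≡ = ≤-trans (≤-reflexive (sym (𝟙-true (F? i p) (∣p∣≡ , refl)))) (≤-∑ (λ i → 𝟙 (F? i p)) i)
    where i = proj₁ (cover (p , ∣p∣≡))
  meet : ∀ i {p q} → F i p → F i q → p ≢ q → ∣ p ∩ q ∣ ≡ h
  meet i (∣p∣≡ , refl) (∣q∣≡ , eq) p≢q =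
    clique i (_ , ∣p∣≡) (_ , ∣q∣≡) (proj₂ (cover _)) (subst (λ i → clq i _) eq (proj₂ (cover _))) (p≢q ∘ cong proj₁)

-- The extended Hamming code

-- The linear map over F₂ whose parity-check matrix has the labels as columns.
syndrome : (Fin n → Subset m) → Subset n → Subset m
syndrome ℓ []            = ⊥
syndrome ℓ (outside ∷ p) = syndrome (ℓ ∘ suc) p
syndrome ℓ (inside ∷ p)  = ℓ zero ⊕ syndrome (ℓ ∘ suc) p

-- In characteristic two, inserting and deleting a point both add its label.
syndrome-toggle : ∀ (ℓ : Fin n → Subset m) i p → syndrome ℓ (toggle i p) ≡ ℓ i ⊕ syndrome ℓ p
syndrome-toggle ℓ zero    (outside ∷ p) = refl
syndrome-toggle ℓ zero    (inside ∷ p)  = sym (⊕-cancelˡ (ℓ zero) _)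
syndrome-toggle ℓ (suc i) (outside ∷ p) = syndrome-toggle (ℓ ∘ suc) i p
syndrome-toggle ℓ (suc i) (inside ∷ p)  = begin
  ℓ₀ ⊕ syndrome (ℓ ∘ suc) (toggle i p)  ≡⟨ cong (ℓ₀ ⊕_) (syndrome-toggle (ℓ ∘ suc) i p) ⟩
  ℓ₀ ⊕ (ℓ (suc i) ⊕ s)                  ≡⟨ ⊕-assoc ℓ₀ _ s ⟨
  ℓ₀ ⊕ ℓ (suc i) ⊕ s                    ≡⟨ cong (_⊕ s) (⊕-comm ℓ₀ _) ⟩
  ℓ (suc i) ⊕ ℓ₀ ⊕ s                    ≡⟨ ⊕-assoc (ℓ (suc i)) ℓ₀ s ⟩
  ℓ (suc i) ⊕ (ℓ₀ ⊕ s)                  ∎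
  where
  open ≡-Reasoning
  ℓ₀ = ℓ zero
  s  = syndrome (ℓ ∘ suc) p

-- Supplies the labelling, one binary digit at a time; here it matters that 2k is a power of two.
Fin2^n↔Subset : ∀ n → Fin (2 ^ n) ↔ Subset n
Fin2^n↔Subset zero    = mk↔ₛ′ (λ _ → []) (λ _ → zero) (λ { [] → refl }) (λ { zero → refl })
Fin2^n↔Subset (suc n) = ↔-trans *↔× (↔-trans (2↔Bool ×-↔ Fin2^n↔Subset n)
  (mk↔ₛ′ (uncurry _∷_) uncons (λ { (_ ∷ _) → refl }) (λ _ → refl)))

-- The cover by balls around codewords

module _ (labelling : Fin (suc h + suc h) ↔ Subset m) where

  open Inverse labelling using (to; from; strictlyInverseˡ; strictlyInverseʳ)

  private
    N = suc h + suc h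

    Code : Subset N → Set
    Code y = syndrome to y ≡ ⊥ × (∣ y ∣ ≡ h ⊎ ∣ y ∣ ≡ 2 + h)

    Code? : Decidable Code
    Code? y = (syndrome to y ≟ˢ ⊥) ×-dec ((∣ y ∣ ≟ h) ⊎-dec (∣ y ∣ ≟ 2 + h))

    #Code : ℕ
    #Code = ∑⊆ (λ y → 𝟙 (Code? y))

    decode : Subset N → Fin N
    decode p = from (syndrome to p)

    toggle-weight : ∀ i (p : Subset N) → ∣ p ∣ ≡ suc h → ∣ toggle i p ∣ ≡ h ⊎ ∣ toggle i p ∣ ≡ 2 + h
    toggle-weight i p ∣p∣≡ with i ∈? p
    ... | yes i∈p = inj₁ (suc-injective (trans (∣toggle∣-∈ i∈p) ∣p∣≡))
    ... | no i∉p  = inj₂ (trans (∣toggle∣-∉ i∉p) (cong suc ∣p∣≡))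

    -- The label sum vanishes after the toggle exactly when the label of `i` equals the label sum of
    -- `p`. Membership in a singleton replaces `i ≡ decode p` so that `∑-𝟙∈` can count the
    -- solutions.
    toggle-Code : ∀ i (p : Subset N) → ∣ p ∣ ≡ suc h → Code (toggle i p) ⇔ i ∈ ⁅ decode p ⁆
    toggle-Code i p ∣p∣≡ = mk⇔ forth back
      where
      forth : Code (toggle i p) → i ∈ ⁅ decode p ⁆
      forth (s≡⊥ , _) = Equivalence.from x∈⁅y⁆⇔x≡y (trans (sym (strictlyInverseʳ i))
        (cong from (⊕≡⊥⇒≡ (trans (sym (syndrome-toggle to i p)) s≡⊥))))
      back : i ∈ ⁅ decode p ⁆ → Code (toggle i p)
      back i∈ with refl ← x∈⁅y⁆⇒x≡y (decode p) i∈ =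
        trans (syndrome-toggle to (decode p) p)
              (trans (cong (_⊕ syndrome to p) (strictlyInverseˡ (syndrome to p))) (⊕-self _))
        , toggle-weight (decode p) p ∣p∣≡

    -- Double count of the pairs of a codeword and a k-set one toggle apart: h + 2 for each
    -- codeword, one for each k-set.
    #Code-sphere : #Code * (2 + h) ≡ N C suc h
    #Code-sphere = begin
      #Code * (2 + h)
        ≡⟨ ∑⊆-*ʳ (2 + h) (λ y → 𝟙 (Code? y)) ⟨
      ∑⊆ (λ y → 𝟙 (Code? y) * (2 + h))
        ≡⟨ ∑⊆-cong (λ y → 𝟙-*-cong (Code? y) λ (_ , ∣y∣≡) → ∑-toggle-degree y ∣y∣≡) ⟨
      ∑⊆ (λ y → 𝟙 (Code? y) * ∑[ i < N ] 𝟙 (∣ toggle i y ∣ ≟ suc h))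
        ≡⟨ ∑⊆-toggle-adjoint (λ y → 𝟙 (Code? y)) (λ p → 𝟙 (∣ p ∣ ≟ suc h)) ⟩
      ∑⊆ (λ p → 𝟙 (∣ p ∣ ≟ suc h) * ∑[ i < N ] 𝟙 (Code? (toggle i p)))
        ≡⟨ ∑⊆-cong (λ p → 𝟙-*-cong (∣ p ∣ ≟ suc h) (unique p)) ⟩
      ∑⊆ (λ (p : Subset N) → 𝟙 (∣ p ∣ ≟ suc h) * 1)
        ≡⟨ ∑⊆-*ʳ 1 (λ (p : Subset N) → 𝟙 (∣ p ∣ ≟ suc h)) ⟩
      ∑⊆ (λ (p : Subset N) → 𝟙 (∣ p ∣ ≟ suc h)) * 1
        ≡⟨ *-identityʳ _ ⟩
      ∑⊆ (λ (p : Subset N) → 𝟙 (∣ p ∣ ≟ suc h))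
        ≡⟨ ∑⊆-𝟙∣∣ N (suc h) ⟩
      N C suc h ∎
      where
      open ≡-Reasoning
      unique : ∀ p → ∣ p ∣ ≡ suc h → ∑[ i < N ] 𝟙 (Code? (toggle i p)) ≡ 1
      unique p ∣p∣≡ = trans (sum-cong-≗ (λ i → 𝟙-cong (toggle-Code i p ∣p∣≡) (Code? (toggle i p)) (i ∈? ⁅ decode p ⁆)))
                            (trans (∑-𝟙∈ ⁅ decode p ⁆) (∣⁅x⁆∣≡1 (decode p)))

    code-cover : CliqueCover (Johnson N (suc h)) #Code
    code-cover = Ball , isClique , covers
      where
      codeword = enumerate Code?
      Ball : Fin #Code → V (Johnson N (suc h)) → Set
      Ball i (p , _) = ∃[ j ] p ≡ toggle j (proj₁ codeword i)
      isClique : ∀ i → IsClique (Johnson N (suc h)) (Ball i)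
      isClique i (p , ∣p∣≡) (q , ∣q∣≡) (j , refl) (l , refl) p≢q =
        -- Distinct vertices have distinct underlying sets, because the size proofs agree.
        ball-adjacent (proj₁ codeword i) j l ∣p∣≡ ∣q∣≡ (p≢q ∘ λ p≡q → Σ-≡,≡→≡ (p≡q , ≡-irrelevant _ _))
      covers : ∀ v → ∃[ i ] Ball i v
      covers (p , ∣p∣≡) with i , eq ← proj₂ codeword (toggle (decode p) p)
                               (Equivalence.from (toggle-Code (decode p) p ∣p∣≡) (x∈⁅x⁆ (decode p))) =
        i , decode p , trans (sym (toggle-involutive (decode p) p)) (cong (toggle (decode p)) (sym eq))

  johnson-cover-number : IsCliqueCoverNumber (Johnson N (suc h)) (catalan (suc h))
  johnson-cover-number = subst (IsCliqueCoverNumber (Johnson N (suc h))) (sym catalan≡)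
    (code-cover , λ m cover → *-cancelʳ-≤ #Code m (2 + h)
                    (≤-trans (≤-reflexive #Code-sphere) (cover-lower-bound cover)))
    where
    catalan≡ : catalan (suc h) ≡ #Code
    -- The binomial coefficient is an exact multiple of `2 + h`, so the truncating division loses
    -- nothing.
    catalan≡ = trans (cong (_/ (2 + h)) (sym #Code-sphere)) (m*n/n≡m #Code (2 + h))

theorem4p12 : (IsCliqueCoverNumber (Johnson 16 8) (catalan 8) × catalan 8 ≡ 1430)
    × (IsCliqueCoverNumber (Johnson 32 16) (catalan 16) × catalan 16 ≡ 35357670)
-- Here 16 = 2^4 and 32 = 2^5; the Catalan values follow by evaluation.
theorem4p12 = (johnson-cover-number (Fin2^n↔Subset 4) , refl)
            , (johnson-cover-number (Fin2^n↔Subset 5) , refl)
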